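{- For each barrier $B$ with base $\mathbb{N}$, $\mathsf{FS}^B\leq_{\mathrm{sW}}\mathsf{RT}^{B^+}_2$.
   Context: $\mathbb{N}$ is the set of natural numbers (including $0$). Subsets of $\mathbb{N}$ are identified with their strictly increasing enumerations; $s\sqsubset Y$ means that $s$ is a proper initial segment of $Y$ as a sequence; $\subset$ is strict set inclusion. A set $B$ of finite subsets of $\mathbb{N}$ is a barrier on an infinite set $X\subseteq\mathbb{N}$ if: (1) $\bigcup B=X$; (2) for all $s,t\in B$, $s\not\subset t$; (3) for every infinite $Y\subseteq X$ there is $s\in B$ with $s\sqsubset Y$. The set $X=\bigcup B$ is the base of $B$. For infinite $Y\subseteq X$, $B\vert Y=\{s\in B: s\subseteq Y\}$ (this is a barrier on $Y$, and every barrier $B'\subseteq B$ has this form). For a barrier $B$ with base $X$, put $X^+=\{x+1:x\in X\}$, $s^+=\{x+1:x\in s\}$ for $s\in B$, and $B^+=\{s^+\cup\{m\}: s\in B,\ m\in X^+,\ m>\max(s)+1\}$; $B^+$ is a barrier with base $X^+$. $\mathsf{FS}^B$ is the problem whose instances are the functions $f:B\to\mathbb{N}$, where a solution to $f$ is an infinite $Y$ contained in the base of $B$ such that for all $s\in B\vert Y$, if $f(s)\in Y$ then $f(s)\in s$. For a barrier $C$ and a positive integer $k$, $\mathsf{RT}^C_k$ is the problem whose instances are the functions $g:C\to k=\{0,\dots,k-1\}$, where a solution to $g$ is an infinite subset $H$ of the base of $C$ such that $g$ is constant on $C\vert H$. Instances and solutions are coded as subsets of $\mathbb{N}$ in a standard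 way, a coloring being given together with its domain (so that the barrier is uniformly computable from a coloring of it). For such problems $\mathsf{P},\mathsf{Q}$, $\mathsf{Q}\leq_{\mathrm{sW}}\mathsf{P}$ (strong Weihrauch reducibility) means: there are Turing functionals $\Phi,\Psi$ such that for every instance $I$ of $\mathsf{Q}$, $\Phi(I)$ is an instance of $\mathsf{P}$, and for every solution $\hat Y$ to $\Phi(I)$, $\Psi(\hat Y)$ is a solution to $I$ for $\mathsf{Q}$. -}

module Defs where

open import Level using (0ℓ)
open import Data.Bool.Base using (Bool; T; if_then_else_)
open import Data.Fin.Base using (Fin; toℕ)
open import Data.List.Base using (List; map; upTo; _∷ʳ_)
open import Data.List.Extrema.Nat using (max)
open import Data.List.Relation.Unary.Linked using (Linked)
import Data.List.Membership.Propositional as List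
open import Data.Nat.Base using (ℕ; zero; suc; _+_; _*_; _^_; _≤_; _<_; _/_; NonZero)
open import Data.Nat.ListAction using (sum)
open import Data.Product.Base using (Σ-syntax; ∃-syntax; _×_; proj₁)
open import Data.Vec.Base using (Vec; []; _∷_; lookup)
open import Function.Bundles using (_⇔_)
open import Relation.Binary.Core using (_Preserves_⟶_)
open import Relation.Binary.PropositionalEquality.Core using (_≡_)
open import Relation.Nullary.Negation.Core using (¬_)
open import Relation.Unary using (Pred; _∈_; _⊆_; _⊂_)

-- The subsets of ℕ that serve as oracles, as codes, as solutions, and as the
-- sets Y over which the definition of a barrier quantifies.

Subsetℕ : Set
Subsetℕ = ℕ → Bool

⟦_⟧ : Subsetℕ → Pred ℕ 0ℓ
⟦ Y ⟧ n = T (Y n)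

Infinite : Pred ℕ 0ℓ → Set
Infinite X = ∀ n → ∃[ m ] n ≤ m × m ∈ X

-- Irrelevance of `increasing` makes a finite set equal to any other with the
-- same list of elements.

record FinSet : Set where
  constructor finSet
  field
    elems       : List ℕ
    .increasing : Linked _<_ elems

open FinSet public

∣_∣ : FinSet → Pred ℕ 0ℓ
∣ s ∣ x = x List.∈ elems s

Enumerates : (ℕ → ℕ) → Subsetℕ → Set
Enumerates e Y = e Preserves _<_ ⟶ _<_ × (∀ n → n ∈ ⟦ Y ⟧ ⇔ (∃[ i ] e i ≡ n))

-- Only infinite Y have an enumeration in the above sense, so that the initial
-- segment is automatically proper.

infix 4 _⊏_
_⊏_ : FinSet → Subsetℕ → Set
s ⊏ Y = ∃[ e ] ∃[ k ] Enumerates e Y × elems s ≡ map e (upTo k)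

Family : Set₁
Family = Pred FinSet 0ℓ

base : Family → Pred ℕ 0ℓ
base B x = ∃[ s ] s ∈ B × x ∈ ∣ s ∣

record IsBarrierOn (X : Pred ℕ 0ℓ) (B : Family) : Set where
  field
    infinite  : Infinite X
    union     : ∀ x → x ∈ base B ⇔ x ∈ X
    antichain : ∀ s t → s ∈ B → t ∈ B → ¬ (∣ s ∣ ⊂ ∣ t ∣)
    covering  : ∀ Y → Infinite ⟦ Y ⟧ → ⟦ Y ⟧ ⊆ X → ∃[ s ] s ∈ B × s ⊏ Y

infix 8 _↾_
_↾_ : Family → Subsetℕ → Family
(B ↾ Y) s = s ∈ B × ∣ s ∣ ⊆ ⟦ Y ⟧

shift : Pred ℕ 0ℓ → Pred ℕ 0ℓ
shift X m = ∃[ x ] x ∈ X × m ≡ suc x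

-- s⁺ ∪ {m} is listed increasingly by appending m, as m exceeds all of s⁺.
-- The default value of max is irrelevant, since ∅ is in no barrier.

infix 9 _⁺
_⁺ : Family → Family
(B ⁺) t = ∃[ s ] ∃[ m ] s ∈ B × m ∈ shift (base B)
                      × max 0 (elems s) + 1 < m
                      × elems t ≡ map suc (elems s) ∷ʳ m

-- Kleene's partial recursive functions relative to an oracle.

data Rec : ℕ → Set where
  zero   : Rec 0
  suc    : Rec 1
  oracle : Rec 1
  proj   : ∀ {n} → Fin n → Rec n
  comp   : ∀ {m n} → Rec m → Vec (Rec n) m → Rec n
  prec   : ∀ {n} → Rec n → Rec (suc (suc n)) → Rec (suc n)
  mu     : ∀ {n} → Rec (suc n) → Rec n

bit : Bool → ℕ
bit b = if b then 1 else 0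

-- A ⊢ f [ xs ]⇓ y : with oracle A, f halts on input xs with output y.

infix 4 _⊢_[_]⇓_
data _⊢_[_]⇓_ (A : Subsetℕ) : ∀ {n} → Rec n → Vec ℕ n → ℕ → Set where
  zero⇓   : A ⊢ zero [ [] ]⇓ 0
  suc⇓    : ∀ {x} → A ⊢ suc [ x ∷ [] ]⇓ suc x
  oracle⇓ : ∀ {x} → A ⊢ oracle [ x ∷ [] ]⇓ bit (A x)
  proj⇓   : ∀ {n} {i : Fin n} {xs} → A ⊢ proj i [ xs ]⇓ lookup xs i
  comp⇓   : ∀ {m n} {f : Rec m} {gs : Vec (Rec n) m} {xs ys z} →
            (∀ i → A ⊢ lookup gs i [ xs ]⇓ lookup ys i) →
            A ⊢ f [ ys ]⇓ z →
            A ⊢ comp f gs [ xs ]⇓ z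
  prec-0⇓ : ∀ {n} {f : Rec n} {g xs z} →
            A ⊢ f [ xs ]⇓ z →
            A ⊢ prec f g [ 0 ∷ xs ]⇓ z
  prec-s⇓ : ∀ {n} {f : Rec n} {g xs k y z} →
            A ⊢ prec f g [ k ∷ xs ]⇓ y →
            A ⊢ g [ k ∷ y ∷ xs ]⇓ z →
            A ⊢ prec f g [ suc k ∷ xs ]⇓ z
  mu⇓     : ∀ {n} {f : Rec (suc n)} {xs y} →
            (∀ i → i < y → ∃[ v ] A ⊢ f [ i ∷ xs ]⇓ suc v) →
            A ⊢ f [ y ∷ xs ]⇓ 0 →
            A ⊢ mu f [ xs ]⇓ y

TuringFunctional : Set
TuringFunctional = Rec 1

-- Φ(A) = Z, where Φ(A) is given by its characteristic function.

_⟨_⟩≐_ : TuringFunctional → Subsetℕ → Subsetℕ → Set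
Φ ⟨ A ⟩≐ Z = ∀ n → A ⊢ Φ [ n ∷ [] ]⇓ bit (Z n)

-- Instances are coded by subsets of ℕ; solutions are themselves such subsets.

record Problem : Set₁ where
  field
    Instance : Set
    Codes    : Subsetℕ → Instance → Set
    Solution : Instance → Subsetℕ → Set

infix 4 _≤sW_
_≤sW_ : Problem → Problem → Set
Q ≤sW P = ∃[ Φ ] ∃[ Ψ ]
  (∀ (I : Q.Instance) (A : Subsetℕ) → Q.Codes A I →
     ∃[ Â ] Σ[ Î ∈ P.Instance ]
       Φ ⟨ A ⟩≐ Â × P.Codes Â Î ×
       (∀ (Ŷ : Subsetℕ) → P.Solution Î Ŷ →
          ∃[ Y ] Ψ ⟨ Ŷ ⟩≐ Y × Q.Solution I Y))
  where
  module Q = Problem Q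
  module P = Problem P

-- The irrelevant argument makes the value of a coloring at s independent of
-- the proof that s is in the family.

Coloring : Family → Set → Set
Coloring B K = ∀ s → .(s ∈ B) → K

-- Canonical index of a finite set, a bijection onto ℕ.

index : FinSet → ℕ
index s = sum (map (2 ^_) (elems s))

-- Cantor's pairing function.

pair : ℕ → ℕ → ℕ
pair a b = (a + b) * suc (a + b) / 2 + b

-- A coloring is coded by the join of its domain and its graph.  As index and
-- pair are bijections, this determines A.

record CodesColoring (B : Family) (A : Subsetℕ) (f : Coloring B ℕ) : Set where
  field
    domain : ∀ s → (2 * index s) ∈ ⟦ A ⟧ ⇔ s ∈ B
    graph  : ∀ s n → (2 * pair (index s) n + 1) ∈ ⟦ A ⟧ ⇔ (Σ[ p ∈ s ∈ B ] f s p ≡ n)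

FS : Family → Problem
FS B = record
  { Instance = Coloring B ℕ
  ; Codes    = CodesColoring B
  ; Solution = λ f Y → Infinite ⟦ Y ⟧ × ⟦ Y ⟧ ⊆ base B ×
      (∀ s (p : s ∈ B ↾ Y) → f s (proj₁ p) ∈ ⟦ Y ⟧ → f s (proj₁ p) ∈ ∣ s ∣)
  }

RT : Family → (k : ℕ) → .{{NonZero k}} → Problem
RT C k = record
  { Instance = Coloring C (Fin k)
  ; Codes    = λ A g → CodesColoring C A (λ s p → toℕ (g s p))
  ; Solution = λ g H → Infinite ⟦ H ⟧ × ⟦ H ⟧ ⊆ base C ×
      (∀ s t (p : s ∈ C ↾ H) (q : t ∈ C ↾ H) → g s (proj₁ p) ≡ g t (proj₁ q))
  }

{-# OPTIONS --safe #-}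

-- Dropping the shift by one, a member of B⁺ is t = s ∪ {m} with s ∈ B and
-- m > max s.  If x = f(s) < m and x ∉ t, let next t be the initial segment of
-- t ∪ {x} that is again of this form; it contains x, since otherwise its part
-- in B would be a proper subset of s.  So t and next t first differ at x, and
-- iterating next climbs lexicographically among the subsets of {0,…,m} until it
-- stops.  Colour t by the parity of the number of steps.  Suppose that H is
-- homogeneous, Y = H − 1, s ∈ B|Y and f(s) ∈ Y ∖ s.  For large m ∈ Y the sets t
-- and next t are both contained in Y, but their colours differ.  Since f(s) only
-- matters when it is below m, bounded searches suffice to compute the colouring,
-- which is therefore primitive recursive in the code of f.

module Submission where

open import Defs
open import Algebra.Properties.CommutativeSemigroup using (x∙yz≈y∙xz)
open import Data.Bool.Base using (Bool; true; false; T; not; if_then_else_; _∧_)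
open import Data.Bool.Properties using (T-∧; T-not-≡; T-≡; not-involutive; not-¬; T?)
open import Data.Empty using (⊥; ⊥-elim)
open import Data.Fin.Base using (Fin; zero; suc; toℕ)
open import Data.List.Base using (List; []; _∷_; map; upTo; _∷ʳ_; filter)
open import Data.List.Extrema.Nat using (xs≤max; max<v⁺)
import Data.List.Membership.Propositional as List
open import Data.List.Membership.Propositional.Properties
  using (∈-filter⁺; ∈-filter⁻; ∈-upTo⁺; ∈-upTo⁻; ∈-map⁺; ∈-map⁻)
open import Data.List.Relation.Unary.All as All using (All; _∷_)
open import Data.List.Relation.Unary.AllPairs using (AllPairs; []; _∷_)
open import Data.List.Relation.Unary.Any using (here; there)
open import Data.List.Relation.Unary.Linked using (Linked; []; [-]; _∷_; linked?)
import Data.List.Relation.Unary.Linked.Properties as Linked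
open import Data.Nat.Base
open import Data.Nat.DivMod using (+-distrib-/-∣ˡ)
open import Data.Nat.Divisibility using (divides-refl)
open import Data.Nat.ListAction using (sum)
open import Data.Nat.Properties
open import Data.Product.Base using (∃-syntax; Σ-syntax; _×_; _,_; proj₁; proj₂)
open import Data.Sum.Base using (_⊎_; inj₁; inj₂; [_,_]′)
open import Data.Unit.Base using (tt)
open import Data.Vec.Base as Vec using (Vec; []; _∷_; lookup; head; tail)
open import Function.Base using (_∘_; id)
open import Function.Bundles using (_⇔_; mk⇔; Equivalence)
open import Relation.Binary.Definitions using (tri<; tri≈; tri>)
open import Relation.Binary.PropositionalEquality
open import Relation.Nullary using (¬_; yes; no; contradiction)
open import Relation.Nullary.Decidable using (recompute)
open import Relation.Unary using (_∈_; U)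

open Equivalence using (to; from)

-- Parity and halving

odd : ℕ → Bool
odd zero    = false
odd (suc n) = not (odd n)

odd-2*+ : ∀ k n → odd (2 * k + n) ≡ odd n
odd-2*+ zero    n = refl
odd-2*+ (suc k) n =
  trans (cong (λ m → odd (m + n)) (*-suc 2 k)) (trans (not-involutive _) (odd-2*+ k n))

⌊2*k+n/2⌋ : ∀ k n → ⌊ 2 * k + n /2⌋ ≡ k + ⌊ n /2⌋
⌊2*k+n/2⌋ zero    n = refl
⌊2*k+n/2⌋ (suc k) n = trans (cong (λ m → ⌊ m + n /2⌋) (*-suc 2 k)) (cong suc (⌊2*k+n/2⌋ k n))

odd-2* : ∀ k → odd (2 * k) ≡ false
odd-2* k = trans (cong odd (sym (+-identityʳ (2 * k)))) (odd-2*+ k 0)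

⌊2*k/2⌋ : ∀ k → ⌊ 2 * k /2⌋ ≡ k
⌊2*k/2⌋ k = trans (cong ⌊_/2⌋ (sym (+-identityʳ (2 * k))))
                  (trans (⌊2*k+n/2⌋ k 0) (+-identityʳ k))

⌊1+n/2⌋ : ∀ n → ⌊ suc n /2⌋ ≡ ⌊ n /2⌋ + bit (odd n)
⌊1+n/2⌋ zero          = refl
⌊1+n/2⌋ (suc zero)    = refl
⌊1+n/2⌋ (suc (suc n)) rewrite not-involutive (odd n) = cong suc (⌊1+n/2⌋ n)

n≡bit+2*⌊n/2⌋ : ∀ n → n ≡ bit (odd n) + 2 * ⌊ n /2⌋
n≡bit+2*⌊n/2⌋ zero          = refl
n≡bit+2*⌊n/2⌋ (suc zero)    = refl
n≡bit+2*⌊n/2⌋ (suc (suc n)) = begin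
  2 + n                                  ≡⟨ cong (2 +_) (n≡bit+2*⌊n/2⌋ n) ⟩
  2 + (bit (odd n) + 2 * ⌊ n /2⌋)        ≡⟨ x∙yz≈y∙xz +-commutativeSemigroup 2 (bit (odd n)) (2 * ⌊ n /2⌋) ⟩
  bit (odd n) + (2 + 2 * ⌊ n /2⌋)        ≡⟨ cong₂ (λ b m → bit b + m) (not-involutive (odd n)) (*-suc 2 ⌊ n /2⌋) ⟨
  bit (odd (2 + n)) + 2 * suc ⌊ n /2⌋    ∎
  where open ≡-Reasoning

even⇒≡2* : ∀ n → odd n ≡ false → n ≡ 2 * ⌊ n /2⌋
even⇒≡2* n e = trans (n≡bit+2*⌊n/2⌋ n) (cong (λ b → bit b + 2 * ⌊ n /2⌋) e)

n/2≡⌊n/2⌋ : ∀ n → n / 2 ≡ ⌊ n /2⌋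
n/2≡⌊n/2⌋ zero          = refl
n/2≡⌊n/2⌋ (suc zero)    = refl
n/2≡⌊n/2⌋ (suc (suc n)) =
  trans (+-distrib-/-∣ˡ {2} n {2} (divides-refl 1)) (cong suc (n/2≡⌊n/2⌋ n))

-- Binary codes of finite sets

shr : ℕ → ℕ → ℕ
shr zero    n = n
shr (suc x) n = ⌊ shr x n /2⌋

testBit : ℕ → ℕ → Bool
testBit x n = odd (shr x n)

-- `shr` halves last, as primitive recursion wants it. Halving first instead peels off the lowest
-- binary digit, which is the form that inductions on sets use.
shr-⌊/2⌋ : ∀ x n → shr (suc x) n ≡ shr x ⌊ n /2⌋
shr-⌊/2⌋ zero    n = refl
shr-⌊/2⌋ (suc x) n = cong ⌊_/2⌋ (shr-⌊/2⌋ x n)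

testBit-suc : ∀ x n → testBit (suc x) n ≡ testBit x ⌊ n /2⌋
testBit-suc x n = cong odd (shr-⌊/2⌋ x n)

infix 4 _ε_

_ε_ : ℕ → ℕ → Set
x ε n = T (testBit x n)

suc-ε : ∀ x n → suc x ε n ⇔ x ε ⌊ n /2⌋
suc-ε x n = mk⇔ (subst T (testBit-suc x n)) (subst T (sym (testBit-suc x n)))

ε-2* : ∀ {x n} → x ε 2 * n ⇔ (∃[ y ] x ≡ suc y × y ε n)
ε-2* {x} {n} = mk⇔ (⇒ x) ⇐
  where
  ⇒ : ∀ x → x ε 2 * n → ∃[ y ] x ≡ suc y × y ε n
  ⇒ zero    p = ⊥-elim (subst T (odd-2* n) p)
  ⇒ (suc y) p = y , refl , subst (y ε_) (⌊2*k/2⌋ n) (to (suc-ε y (2 * n)) p)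
  ⇐ : ∃[ y ] x ≡ suc y × y ε n → x ε 2 * n
  ⇐ (y , refl , p) = from (suc-ε y (2 * n)) (subst (y ε_) (sym (⌊2*k/2⌋ n)) p)

-- Induction on `x` by halving, which strictly decreases a positive number. This bound is what makes
-- the later searches through a coded set finite.
ε⇒< : ∀ x n → x ε n → x < n
ε⇒< x       zero    p = ⊥-elim (subst T (shr-0 x) p)
  where
  shr-0 : ∀ x → testBit x 0 ≡ false
  shr-0 zero    = refl
  shr-0 (suc x) = trans (testBit-suc x 0) (shr-0 x)
ε⇒< zero    (suc n) p = z<s
ε⇒< (suc x) (suc n) p =
  ≤-<-trans (ε⇒< x ⌊ suc n /2⌋ (to (suc-ε x (suc n)) p)) (⌊n/2⌋<n n)

¬ε0 : ∀ x → ¬ x ε 0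
¬ε0 x p = n≮0 (ε⇒< x 0 p)

T-ext : ∀ {a b} → (T a → T b) → (T b → T a) → a ≡ b
T-ext {false} {false} _ _ = refl
T-ext {false} {true}  _ g = ⊥-elim (g _)
T-ext {true}  {false} f _ = ⊥-elim (f _)
T-ext {true}  {true}  _ _ = refl

-- The lowest digits agree by membership of 0, and the halves agree by induction on a common bound
-- of both numbers.
ε-ext : ∀ {a b} → (∀ x → x ε a → x ε b) → (∀ x → x ε b → x ε a) → a ≡ b
ε-ext {a} {b} f g = ext (a ⊔ b) (m≤m⊔n a b) (m≤n⊔m a b) f g
  where
  ext : ∀ N {a b} → a ≤ N → b ≤ N →
        (∀ x → x ε a → x ε b) → (∀ x → x ε b → x ε a) → a ≡ b
  ⌊/2⌋-≤ : ∀ {a N} → a ≤ suc N → ⌊ a /2⌋ ≤ N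
  ⌊/2⌋-≤ {zero}  _ = z≤n
  ⌊/2⌋-≤ {suc a} p = ≤-pred (≤-trans (⌊n/2⌋<n a) p)
  ext zero z≤n z≤n _ _ = refl
  ext (suc N) {a} {b} a≤ b≤ f g = trans (n≡bit+2*⌊n/2⌋ a) (trans
    (cong₂ (λ c h → bit c + 2 * h) (T-ext (f 0) (g 0))
      (ext N (⌊/2⌋-≤ a≤) (⌊/2⌋-≤ b≤)
        (λ x → to (suc-ε x b) ∘ f (suc x) ∘ from (suc-ε x a))
        (λ x → to (suc-ε x a) ∘ g (suc x) ∘ from (suc-ε x b))))
    (sym (n≡bit+2*⌊n/2⌋ b)))

-- Digit `x` of `n` is 0, so the addition produces no carry and amounts to inserting `x`.
ε-2^+ : ∀ x n → ¬ x ε n → ∀ y → y ε 2 ^ x + n ⇔ (y ≡ x ⊎ y ε n)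
ε-2^+ zero n x∉n zero = mk⇔ (λ _ → inj₁ refl) (λ _ → odd-suc n x∉n)
  where
  odd-suc : ∀ n → ¬ T (odd n) → T (odd (suc n))
  odd-suc n p with odd n
  ... | false = _
  ... | true  = p _
ε-2^+ zero n x∉n (suc y) = mk⇔ (inj₂ ∘ subst T eq) [ (λ ()) , subst T (sym eq) ]′
  where
  even : ∀ b → ¬ T b → bit b ≡ 0
  even false _ = refl
  even true  p = ⊥-elim (p _)
  eq : testBit (suc y) (suc n) ≡ testBit (suc y) n
  eq = trans (testBit-suc y (suc n)) (trans
    (cong (testBit y) (trans (⌊1+n/2⌋ n)
      (trans (cong (⌊ n /2⌋ +_) (even (odd n) x∉n)) (+-identityʳ _))))
    (sym (testBit-suc y n)))
ε-2^+ (suc x) n x∉n zero =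
  mk⇔ (inj₂ ∘ subst T (odd-2*+ (2 ^ x) n)) [ (λ ()) , subst T (sym (odd-2*+ (2 ^ x) n)) ]′
ε-2^+ (suc x) n x∉n (suc y) = mk⇔
  (λ p → [ inj₁ ∘ cong suc , inj₂ ∘ from (suc-ε y n) ]′
    (to ih (subst (y ε_) (⌊2*k+n/2⌋ (2 ^ x) n) (to (suc-ε y _) p))))
  (λ p → from (suc-ε y _) (subst (y ε_) (sym (⌊2*k+n/2⌋ (2 ^ x) n))
    (from ih ([ inj₁ ∘ suc-injective , inj₂ ∘ to (suc-ε y n) ]′ p))))
  where
  ih = ε-2^+ x ⌊ n /2⌋ (x∉n ∘ from (suc-ε x n)) y

-- The remainder of `n` modulo `2 ^ j`, summed digit by digit so that it is primitive recursive as
-- it stands.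
low : ℕ → ℕ → ℕ
low zero    n = 0
low (suc j) n = bit (testBit j n) * 2 ^ j + low j n

ε-low : ∀ j n x → x ε low j n ⇔ (x < j × x ε n)
ε-low zero    n x = mk⇔ (⊥-elim ∘ ¬ε0 x) (λ ())
ε-low (suc j) n x with testBit j n in eq
... | false = mk⇔
  (λ p → let x<j , x∈ = to (ε-low j n x) p in m<n⇒m<1+n x<j , x∈)
  λ (x<1+j , x∈) → from (ε-low j n x)
    (≤∧≢⇒< (≤-pred x<1+j) (λ { refl → subst T eq x∈ }) , x∈)
... | true rewrite +-identityʳ (2 ^ j) = mk⇔
  (λ p → [ (λ { refl → ≤-refl , subst T (sym eq) _ })
         , (λ q → let x<j , x∈ = to (ε-low j n x) q in m<n⇒m<1+n x<j , x∈) ]′ (to ins p))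
  λ (x<1+j , x∈) → from ins ([ (λ x<j → inj₂ (from (ε-low j n x) (x<j , x∈))) , inj₁ ]′
    (m≤n⇒m<n∨m≡n (≤-pred x<1+j)))
  where
  ins = ε-2^+ j (low j n) (λ p → <-irrefl refl (proj₁ (to (ε-low j n j) p))) x

-- Canonical indices and increasing lists

∈-index : ∀ l → Linked _<_ l → ∀ x → x ε sum (map (2 ^_) l) ⇔ x List.∈ l
∈-index l p = ∈-index′ l (Linked.Linked⇒AllPairs <-trans p)
  where
  ∈-index′ : ∀ l → AllPairs _<_ l → ∀ x → x ε sum (map (2 ^_) l) ⇔ x List.∈ l
  ∈-index′ []      _       x = mk⇔ (⊥-elim ∘ ¬ε0 x) (λ ())
  ∈-index′ (a ∷ l) (q ∷ p) x = mk⇔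
    (λ r → [ here , there ∘ to (∈-index′ l p x) ]′ (to ins r))
    (λ { (here r)  → from ins (inj₁ r)
       ; (there r) → from ins (inj₂ (from (∈-index′ l p x) r)) })
    where
    ins = ε-2^+ a _ (λ r → <-irrefl refl (All.lookup q (to (∈-index′ l p a) r))) x

-- Being increasing is decidable, so the irrelevant proof can be recomputed.
increasing! : ∀ s → Linked _<_ (elems s)
increasing! (finSet l p) = recompute (linked? _<?_ l) p

ε-index : ∀ s x → x ε index s ⇔ x List.∈ elems s
ε-index s = ∈-index (elems s) (increasing! s)

toSet : ℕ → FinSet
toSet n = finSet (filter (λ x → T? (testBit x n)) (upTo n))
  (Linked.filter⁺ _ <-trans (Linked.applyUpTo⁺₂ id n (λ _ → ≤-refl)))

∈-toSet : ∀ n x → x List.∈ elems (toSet n) ⇔ x ε n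
∈-toSet n x = mk⇔ (proj₂ ∘ ∈-filter⁻ (λ x → T? (testBit x n)) {xs = upTo n})
  (λ p → ∈-filter⁺ (λ x → T? (testBit x n)) (∈-upTo⁺ (ε⇒< x n p)) p)

index-toSet : ∀ n → index (toSet n) ≡ n
index-toSet n = ε-ext
  (λ x → to (∈-toSet n x) ∘ to (ε-index (toSet n) x))
  (λ x → from (ε-index (toSet n) x) ∘ from (∈-toSet n x))

-- Shifting doubles every power of 2, and the appended term can be moved to the front of the sum.
-- Thus a member of `B ⁺` has twice the code of the unshifted set `s ∪ {m}`.
index-⁺ : ∀ l m → sum (map (2 ^_) (map suc l ∷ʳ suc m)) ≡ 2 * (2 ^ m + sum (map (2 ^_) l))
index-⁺ []      m = trans (+-identityʳ _) (cong (2 *_) (sym (+-identityʳ (2 ^ m))))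
index-⁺ (a ∷ l) m = begin
  2 ^ suc a + sum (map (2 ^_) (map suc l ∷ʳ suc m)) ≡⟨ cong (2 ^ suc a +_) (index-⁺ l m) ⟩
  2 * 2 ^ a + 2 * (2 ^ m + rest)                    ≡⟨ *-distribˡ-+ 2 (2 ^ a) (2 ^ m + rest) ⟨
  2 * (2 ^ a + (2 ^ m + rest))                      ≡⟨ cong (2 *_) (x∙yz≈y∙xz +-commutativeSemigroup (2 ^ a) (2 ^ m) rest) ⟩
  2 * (2 ^ m + (2 ^ a + rest))                      ∎
  where
  open ≡-Reasoning
  rest = sum (map (2 ^_) l)

-- Each head is the minimum of its list, so the heads agree, and then the tails have the same
-- elements. Membership in `B ⁺` is an equation between lists, which this reduces to an equality of
-- sets.
increasing-ext : ∀ {k l} → Linked _<_ k → Linked _<_ l →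
                 (∀ x → x List.∈ k → x List.∈ l) → (∀ x → x List.∈ l → x List.∈ k) → k ≡ l
increasing-ext p q = ext (Linked.Linked⇒AllPairs <-trans p) (Linked.Linked⇒AllPairs <-trans q)
  where
  ext : ∀ {k l} → AllPairs _<_ k → AllPairs _<_ l →
        (∀ x → x List.∈ k → x List.∈ l) → (∀ x → x List.∈ l → x List.∈ k) → k ≡ l
  ext [] [] f g = refl
  ext [] (_ ∷ _) f g with () ← g _ (here refl)
  ext (_ ∷ _) [] f g with () ← f _ (here refl)
  ext {a ∷ k} {b ∷ l} (p ∷ ps) (q ∷ qs) f g = cong₂ _∷_ a≡b
    (ext ps qs (tail-⊆ a≡b p f) (tail-⊆ (sym a≡b) q g))
    where
    tail-⊆ : ∀ {a b k l} → a ≡ b → All (a <_) k →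
             (∀ x → x List.∈ a ∷ k → x List.∈ b ∷ l) → ∀ x → x List.∈ k → x List.∈ l
    tail-⊆ refl p f x x∈ with f x (there x∈)
    ... | here refl = contradiction (All.lookup p x∈) (<-irrefl refl)
    ... | there y   = y
    a≡b : a ≡ b
    a≡b with f a (here refl) | g b (here refl)
    ... | here e   | _        = e
    ... | there _  | here e   = sym e
    ... | there a∈ | there b∈ = contradiction (All.lookup q a∈) (<-asym (All.lookup p b∈))

-- least b P is b if no k < b satisfies P.
-- Opaque, since unfolding nested searches makes conversion checking explode.
opaque
  least : ℕ → (ℕ → Bool) → ℕ
  least zero    P = 0
  least (suc b) P = if P (least b P) then least b P else suc (least b P)

  least-finds-or-fails : ∀ b P → T (P (least b P)) ⊎ least b P ≡ b
  least-finds-or-fails zero    P = inj₂ refl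
  least-finds-or-fails (suc b) P with P (least b P) in eq
  ... | true  = inj₁ (subst T (sym eq) _)
  ... | false = [ (⊥-elim ∘ subst T eq) , inj₂ ∘ cong suc ]′ (least-finds-or-fails b P)

  least-minimal : ∀ b P {k} → k < least b P → ¬ T (P k)
  least-minimal (suc b) P k< with P (least b P) in eq
  ... | true  = least-minimal b P k<
  ... | false = [ least-minimal b P , (λ { refl → subst T eq }) ]′ (m≤n⇒m<n∨m≡n (≤-pred k<))

least-finds : ∀ b P {k} → k < b → T (P k) → T (P (least b P))
least-finds b P {k} k<b Pk = [ id ,
  (λ e → contradiction Pk (least-minimal b P (subst (k <_) (sym e) k<b))) ]′ (least-finds-or-fails b P)

-- Cantor's pairing

triangle : ℕ → ℕ
triangle k = k * suc k / 2

triangle-suc : ∀ k → triangle (suc k) ≡ suc k + triangle k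
triangle-suc k = trans (n/2≡⌊n/2⌋ (suc k * suc (suc k))) (trans (cong ⌊_/2⌋ eq)
  (trans (⌊2*k+n/2⌋ (suc k) (k * suc k)) (cong (suc k +_) (sym (n/2≡⌊n/2⌋ (k * suc k))))))
  where
  eq : suc k * suc (suc k) ≡ 2 * suc k + k * suc k
  eq = trans (*-comm (suc k) (suc (suc k))) (*-distribʳ-+ (suc k) 2 k)

triangle-mono : ∀ {j k} → j ≤ k → triangle j ≤ triangle k
triangle-mono {zero}  {k}     _ = z≤n
triangle-mono {suc j} {suc k} (s≤s p) rewrite triangle-suc j | triangle-suc k =
  +-mono-≤ (s≤s p) (triangle-mono p)

-- The pairs with sum `j` are numbered from `triangle j` to `triangle j + j`, and the next diagonal
-- starts one later.
triangle-gap : ∀ {j k b c} → j < k → b ≤ j → triangle j + b < triangle k + c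
triangle-gap {j} {k} {b} {c} j<k b≤j = begin-strict
  triangle j + b       ≤⟨ +-monoʳ-≤ (triangle j) b≤j ⟩
  triangle j + j       <⟨ n<1+n _ ⟩
  suc (triangle j + j) ≡⟨ cong suc (+-comm (triangle j) j) ⟩
  suc j + triangle j   ≡⟨ triangle-suc j ⟨
  triangle (suc j)     ≤⟨ triangle-mono j<k ⟩
  triangle k           ≤⟨ m≤m+n _ c ⟩
  triangle k + c       ∎
  where open ≤-Reasoning

pair-injective : ∀ a b c d → pair a b ≡ pair c d → a ≡ c × b ≡ d
pair-injective a b c d e with <-cmp (a + b) (c + d)
... | tri< lt _ _ = contradiction e (<⇒≢ (triangle-gap lt (m≤n+m b a)))
... | tri> _ _ gt = contradiction (sym e) (<⇒≢ (triangle-gap gt (m≤n+m d c)))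
... | tri≈ _ s _  = +-cancelʳ-≡ b a c (trans s (cong (c +_) (sym b≡d))) , b≡d
  where
  b≡d : b ≡ d
  b≡d = +-cancelˡ-≡ (triangle (a + b)) b d (trans e (cong (λ k → triangle k + d) (sym s)))

≤pair : ∀ a b → a ≤ pair a b
≤pair a b = ≤-trans (m≤m+n a b) (≤-trans (k≤triangle (a + b)) (m≤m+n _ b))
  where
  k≤triangle : ∀ k → k ≤ triangle k
  k≤triangle zero    = z≤n
  k≤triangle (suc k) rewrite triangle-suc k = m≤m+n (suc k) _

-- Programs for total oracle functions

-- A value in X is output as its code under enc.

record Computable {X : Set} (enc : X → ℕ) (n : ℕ) : Set where
  field
    prog    : Rec n
    value   : Subsetℕ → Vec ℕ n → X
    correct : ∀ A xs → A ⊢ prog [ xs ]⇓ enc (value A xs)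

open Computable

Term Formula : ℕ → Set
Term    = Computable id
Formula = Computable bit

private variable
  X X′ : Set
  enc : X → ℕ
  l n : ℕ

-- Keeps the program and replaces the description of its value, so that later proofs see the
-- intended function and not its recursive construction.
as : {enc : X → ℕ} (enc′ : X′ → ℕ) (t : Computable enc n) (F : Subsetℕ → Vec ℕ n → X′) →
     (∀ A xs → enc (value t A xs) ≡ enc′ (F A xs)) → Computable enc′ n
as enc′ t F eq = record
  { prog    = prog t
  ; value   = F
  ; correct = λ A xs → subst (A ⊢ prog t [ xs ]⇓_) (eq A xs) (correct t A xs) }

var : Fin n → Term n
var i = record { prog = proj i ; value = λ A xs → lookup xs i ; correct = λ A xs → proj⇓ }

app : Computable enc l → Vec (Term n) l → Computable enc n
app f ts = record
  { prog    = comp (prog f) (Vec.map prog ts)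
  ; value   = λ A xs → value f A (Vec.map (λ t → value t A xs) ts)
  ; correct = λ A xs → comp⇓ (args ts A xs) (correct f A _) }
  where
  args : (ts : Vec (Term n) l) → ∀ A xs i →
         A ⊢ lookup (Vec.map prog ts) i [ xs ]⇓ lookup (Vec.map (λ t → value t A xs) ts) i
  args (t ∷ ts) A xs zero    = correct t A xs
  args (t ∷ ts) A xs (suc i) = args ts A xs i

natrec : X → (ℕ → X → X) → ℕ → X
natrec z s zero    = z
natrec z s (suc k) = s k (natrec z s k)

-- In the step, `v₀` is the counter and `v₁` the previous result; the parameters follow.
rec : Term n → Term (suc (suc n)) → Term (suc n)
rec z s = record
  { prog    = prec (prog z) (prog s)
  ; value   = λ A xs → natrec (value z A (tail xs)) (λ k r → value s A (k ∷ r ∷ tail xs)) (head xs)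
  ; correct = λ { A (k ∷ xs) → loop A k xs } }
  where
  loop : ∀ A k xs → A ⊢ prec (prog z) (prog s) [ k ∷ xs ]⇓
         natrec (value z A xs) (λ k r → value s A (k ∷ r ∷ xs)) k
  loop A zero    xs = prec-0⇓ (correct z A xs)
  loop A (suc k) xs = prec-s⇓ (loop A k xs) (correct s A _)

sucᶜ : Term n → Term n
sucᶜ t = app (record { prog = suc ; value = λ { A (x ∷ []) → suc x }
                             ; correct = λ { A (x ∷ []) → suc⇓ } }) (t ∷ [])

oracleᶜ : Term n → Formula n
oracleᶜ t = app (record { prog = oracle ; value = λ { A (x ∷ []) → A x }
                        ; correct = λ { A (x ∷ []) → oracle⇓ } }) (t ∷ [])

const : ℕ → Term n
const zero    = record { prog = comp zero [] ; value = λ _ _ → 0 ; correct = λ _ _ → comp⇓ {ys = []} (λ ()) zero⇓ }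
const (suc c) = sucᶜ (const c)

-- Arithmetic, logic and bounded search as programs

pattern v₀ = zero
pattern v₁ = suc zero
pattern v₂ = suc (suc zero)

plus₂ times₂ monus₂ power₂ : Term 2
plus₂ = as id (rec (var v₀) (sucᶜ (var v₁))) (λ { A (x ∷ y ∷ []) → x + y }) λ { A (x ∷ y ∷ []) → eq x y }
  where
  eq : ∀ x y → natrec y (λ _ → suc) x ≡ x + y
  eq zero    y = refl
  eq (suc x) y = cong suc (eq x y)

infixl 6 _+ᶜ_ _∸ᶜ_
infixl 7 _*ᶜ_

_+ᶜ_ _*ᶜ_ _∸ᶜ_ _^ᶜ_ : Term n → Term n → Term n
s +ᶜ t = app plus₂ (s ∷ t ∷ [])

times₂ = as id (rec (const 0) (var v₂ +ᶜ var v₁)) (λ { A (x ∷ y ∷ []) → x * y }) λ { A (x ∷ y ∷ []) → eq x y }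
  where
  eq : ∀ x y → natrec 0 (λ _ r → y + r) x ≡ x * y
  eq zero    y = refl
  eq (suc x) y = cong (y +_) (eq x y)

s *ᶜ t = app times₂ (s ∷ t ∷ [])

predᶜ : Term n → Term n
predᶜ t = app (as id (rec (const 0) (var v₀)) (λ { A (x ∷ []) → pred x })
                (λ { A (zero ∷ []) → refl ; A (suc x ∷ []) → refl })) (t ∷ [])

-- `rec` recurses on its first argument, while truncated subtraction recurses on the second; hence
-- the exchange of the two variables.
monus₂ = as id (app (rec (var v₀) (predᶜ (var v₁))) (var v₁ ∷ var v₀ ∷ []))
  (λ { A (x ∷ y ∷ []) → x ∸ y }) λ { A (x ∷ y ∷ []) → eq x y }
  where
  eq : ∀ x y → natrec x (λ _ → pred) y ≡ x ∸ y
  eq x zero    = refl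
  eq x (suc y) = trans (cong pred (eq x y)) (pred[m∸n]≡m∸[1+n] x y)

s ∸ᶜ t = app monus₂ (s ∷ t ∷ [])

power₂ = as id (app (rec (const 1) (var v₂ *ᶜ var v₁)) (var v₁ ∷ var v₀ ∷ []))
  (λ { A (x ∷ y ∷ []) → x ^ y }) λ { A (x ∷ y ∷ []) → eq x y }
  where
  eq : ∀ x y → natrec 1 (λ _ r → x * r) y ≡ x ^ y
  eq x zero    = refl
  eq x (suc y) = cong (x *_) (eq x y)

s ^ᶜ t = app power₂ (s ∷ t ∷ [])

bitᶜ : Formula n → Term n
bitᶜ p = as id p (λ A xs → bit (value p A xs)) (λ _ _ → refl)

infixr 6 _∧ᶜ_

_∧ᶜ_ : Formula n → Formula n → Formula n
p ∧ᶜ q = as bit (bitᶜ p *ᶜ bitᶜ q) (λ A xs → value p A xs ∧ value q A xs)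
  λ A xs → eq (value p A xs) (value q A xs)
  where
  eq : ∀ a b → bit a * bit b ≡ bit (a ∧ b)
  eq false b     = refl
  eq true  false = refl
  eq true  true  = refl

notᶜ : Formula n → Formula n
notᶜ p = as bit (const 1 ∸ᶜ bitᶜ p) (λ A xs → not (value p A xs)) λ A xs → eq (value p A xs)
  where
  eq : ∀ a → 1 ∸ bit a ≡ bit (not a)
  eq false = refl
  eq true  = refl

-- Both branches are total, so the choice can be made arithmetically, with the bit of `p` and that
-- of its negation as weights.
ifᶜ : Formula n → Computable enc n → Computable enc n → Computable enc n
ifᶜ {enc = enc} p s t = as enc (bitᶜ p *ᶜ code s +ᶜ (bitᶜ (notᶜ p)) *ᶜ code t)
  (λ A xs → if value p A xs then value s A xs else value t A xs)
  λ A xs → eq (value p A xs) (value s A xs) (value t A xs)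
  where
  code : Computable enc n → Term n
  code s = as id s (λ A xs → enc (value s A xs)) (λ _ _ → refl)
  eq : ∀ b x y → bit b * enc x + bit (not b) * enc y ≡ enc (if b then x else y)
  eq false x y = +-identityʳ (enc y)
  eq true  x y = trans (+-identityʳ _) (+-identityʳ (enc x))

-- Subtraction from 1 tests for zero: `x < y` if `y ∸ x` is not zero, and `x ≡ y` if both truncated
-- differences are.
_<ᶜ_ _≡ᶜ_ : Term n → Term n → Formula n
s <ᶜ t = as bit (const 1 ∸ᶜ (const 1 ∸ᶜ (t ∸ᶜ s))) (λ A xs → value s A xs <ᵇ value t A xs)
  λ A xs → eq (value s A xs) (value t A xs)
  where
  eq : ∀ x y → 1 ∸ (1 ∸ (y ∸ x)) ≡ bit (x <ᵇ y)
  eq x       zero    rewrite 0∸n≡0 x = refl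
  eq zero    (suc y) rewrite 0∸n≡0 y = refl
  eq (suc x) (suc y) = eq x y
s ≡ᶜ t = as bit (const 1 ∸ᶜ ((s ∸ᶜ t) +ᶜ (t ∸ᶜ s))) (λ A xs → value s A xs ≡ᵇ value t A xs)
  λ A xs → eq (value s A xs) (value t A xs)
  where
  eq : ∀ x y → 1 ∸ ((x ∸ y) + (y ∸ x)) ≡ bit (x ≡ᵇ y)
  eq zero    zero    = refl
  eq zero    (suc y) rewrite 0∸n≡0 y = refl
  eq (suc x) zero    rewrite +-identityʳ x | 0∸n≡0 x = refl
  eq (suc x) (suc y) = eq x y

oddᶜ : Term n → Formula n
oddᶜ t = app (as bit (rec (const 0) (const 1 ∸ᶜ var v₁)) (λ { A (x ∷ []) → odd x }) λ { A (x ∷ []) → eq x }) (t ∷ [])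
  where
  eq : ∀ x → natrec 0 (λ _ → 1 ∸_) x ≡ bit (odd x)
  eq zero = refl
  eq (suc x) rewrite eq x with odd x
  ... | false = refl
  ... | true  = refl

halfᶜ : Term n → Term n
halfᶜ t = app (as id (rec (const 0) (var v₁ +ᶜ bitᶜ (oddᶜ (var v₀)))) (λ { A (x ∷ []) → ⌊ x /2⌋ }) λ { A (x ∷ []) → eq x })
  (t ∷ [])
  where
  eq : ∀ x → natrec 0 (λ k r → r + bit (odd k)) x ≡ ⌊ x /2⌋
  eq zero    = refl
  eq (suc x) = trans (cong (_+ bit (odd x)) (eq x)) (sym (⌊1+n/2⌋ x))

testBitᶜ : Term n → Term n → Formula n
testBitᶜ x u = oddᶜ (app (as id (rec (var v₀) (halfᶜ (var v₁))) (λ { A (x ∷ u ∷ []) → shr x u }) λ { A (x ∷ u ∷ []) → eq x u })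
  (x ∷ u ∷ []))
  where
  eq : ∀ x u → natrec u (λ _ → ⌊_/2⌋) x ≡ shr x u
  eq zero    u = refl
  eq (suc x) u = cong ⌊_/2⌋ (eq x u)

lowᶜ : Term n → Term n → Term n
lowᶜ j u = app (as id (rec (const 0) (bitᶜ (testBitᶜ (var v₀) (var v₂)) *ᶜ const 2 ^ᶜ var v₀ +ᶜ var v₁))
                 (λ { A (j ∷ u ∷ []) → low j u }) λ { A (j ∷ u ∷ []) → eq j u }) (j ∷ u ∷ [])
  where
  eq : ∀ j u → natrec 0 (λ k r → bit (testBit k u) * 2 ^ k + r) j ≡ low j u
  eq zero    u = refl
  eq (suc j) u = cong (bit (testBit j u) * 2 ^ j +_) (eq j u)

pairᶜ : Term n → Term n → Term n
pairᶜ s t = as id (halfᶜ ((s +ᶜ t) *ᶜ sucᶜ (s +ᶜ t)) +ᶜ t) (λ A xs → pair (value s A xs) (value t A xs))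
  λ A xs → cong (_+ value t A xs) (sym (n/2≡⌊n/2⌋ ((value s A xs + value t A xs) * suc (value s A xs + value t A xs))))

opaque
  unfolding least

  natrec-least : ∀ P b → natrec 0 (λ _ r → if P r then r else suc r) b ≡ least b P
  natrec-least P zero    = refl
  natrec-least P (suc b) rewrite natrec-least P b = refl

-- The recursion carries the current candidate, which stays put once it satisfies `P`. The search is
-- thus total without recourse to `mu`.
leastᶜ : Term 1 → Formula 2 → Term 1
leastᶜ b P = as id
  (app (rec (const 0) (ifᶜ (app P (var v₁ ∷ var v₂ ∷ [])) (var v₁) (sucᶜ (var v₁)))) (b ∷ var v₀ ∷ []))
  (λ A xs → least (value b A xs) (λ k → value P A (k ∷ xs)))
  λ { A (u ∷ []) → natrec-least (λ k → value P A (k ∷ u ∷ [])) (value b A (u ∷ [])) }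

-- Lexicographic order on sets bounded by M

-- The binary number with leading digit `φ 0`: contrary to the codes of sets, small elements weigh
-- most here.
lexValue : ℕ → (ℕ → Bool) → ℕ
lexValue zero    φ = 0
lexValue (suc M) φ = bit (φ 0) * 2 ^ M + lexValue M (φ ∘ suc)

lexValue<2^ : ∀ M φ → lexValue M φ < 2 ^ M
lexValue<2^ zero    φ = z<s
lexValue<2^ (suc M) φ = begin-strict
  bit (φ 0) * 2 ^ M + lexValue M (φ ∘ suc) <⟨ +-mono-≤-< (*-monoˡ-≤ (2 ^ M) (bit≤1 (φ 0))) (lexValue<2^ M (φ ∘ suc)) ⟩
  1 * 2 ^ M + 2 ^ M                        ≡⟨ +-comm (1 * 2 ^ M) (2 ^ M) ⟩
  2 ^ suc M                                ∎
  where
  open ≤-Reasoning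
  bit≤1 : ∀ b → bit b ≤ 1
  bit≤1 false = z≤n
  bit≤1 true  = ≤-refl

-- At the first difference, the digit gained by `ψ` outweighs all later digits together, by
-- `lexValue<2^`.
lexValue-< : ∀ M x φ ψ → x < M → (∀ y → y < x → φ y ≡ ψ y) → φ x ≡ false → ψ x ≡ true →
             lexValue M φ < lexValue M ψ
lexValue-< (suc M) zero φ ψ _ _ p q rewrite p | q =
  <-≤-trans (lexValue<2^ M (φ ∘ suc)) (≤-trans (m≤m+n (2 ^ M) 0) (m≤m+n _ _))
lexValue-< (suc M) (suc x) φ ψ (s≤s x<M) agree p q rewrite agree 0 z<s =
  +-monoʳ-< _ (lexValue-< M x (φ ∘ suc) (ψ ∘ suc) x<M (λ y y<x → agree (suc y) (s<s y<x)) p q)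

-- The colouring and its program

-- Here A codes f and u codes a set t.  Then top A u is the largest element m of
-- t, low m u codes s = t ∖ {m}, and isCode A u says that s ∈ B.

topAt : Subsetℕ → ℕ → ℕ → Bool
topAt A u m = testBit m u ∧ (low (suc m) u ≡ᵇ u) ∧ A (2 * low m u)

top : Subsetℕ → ℕ → ℕ
top A u = least u (topAt A u)

opaque
  isCode : Subsetℕ → ℕ → Bool
  isCode A u = topAt A u (top A u)

  isCode-def : ∀ A u → topAt A u (top A u) ≡ isCode A u
  isCode-def A u = refl

-- x = f(s), with x < m and x ∉ t.

valueAt : Subsetℕ → ℕ → ℕ → Bool
valueAt A u x = (x <ᵇ top A u) ∧ not (testBit x u) ∧ A (2 * pair (low (top A u) u) x + 1)

opaque
  newElement : Subsetℕ → ℕ → ℕ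
  newElement A u = least u (valueAt A u)

  newElement-def : ∀ A u → least u (valueAt A u) ≡ newElement A u
  newElement-def A u = refl

extended : Subsetℕ → ℕ → ℕ
extended A u = 2 ^ newElement A u + u

-- If `u` is a code and the new element satisfies `valueAt`, then `cut-exists` provides a cut of at
-- most `u`, hence the bound `suc u`.
cut : Subsetℕ → ℕ → ℕ
cut A u = least (suc u) (λ j → isCode A (low j (extended A u)))

opaque
  next : Subsetℕ → ℕ → ℕ
  next A u = low (cut A u) (extended A u)

  next-def : ∀ A u → low (cut A u) (extended A u) ≡ next A u
  next-def A u = refl

opaque
  moves : Subsetℕ → ℕ → Bool
  moves A u = valueAt A u (newElement A u) ∧ isCode A (next A u)

  moves-def : ∀ A u → valueAt A u (newElement A u) ∧ isCode A (next A u) ≡ moves A u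
  moves-def A u = refl

orbit : Subsetℕ → ℕ → ℕ → ℕ
orbit A zero    u = u
orbit A (suc k) u = next A (orbit A k u)

opaque
  -- From a code `u`, every move raises the lexicographic value, and the sets reached contain only
  -- numbers below `u`; so there are fewer than `2 ^ u` moves.
  steps : Subsetℕ → ℕ → ℕ
  steps A u = least (2 ^ u) (λ k → not (moves A (orbit A k u)))

  steps-def : ∀ A u → least (2 ^ u) (λ k → not (moves A (orbit A k u))) ≡ steps A u
  steps-def A u = refl

colour : Subsetℕ → ℕ → Bool
colour A u = odd (steps A u)

-- Shifting a set by one doubles its code, so that 2 * u is the index of t⁺.

graphOf : Subsetℕ → ℕ → ℕ → Bool
graphOf A N u = isCode A u ∧ (pair (2 * u) (bit (colour A u)) ≡ᵇ N)

-- Recovers the set from a point `N` of the graph. The bound suffices because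
-- `u ≤ 2 * u ≤ pair (2 * u) b` for every `b`.
coded : Subsetℕ → ℕ → ℕ
coded A N = least (suc N) (graphOf A N)

-- Members of `B ⁺` consist of positive numbers, so only even indices can belong to the domain.
inDomain inGraph : Subsetℕ → ℕ → Bool
inDomain A k = not (odd k) ∧ isCode A ⌊ k /2⌋
inGraph  A N = graphOf A N (coded A N)

colouringCode : Subsetℕ → Subsetℕ
colouringCode A n = if odd n then inGraph A ⌊ n /2⌋ else inDomain A ⌊ n /2⌋

-- Programs for the stages of the colouring

topᶜ newᶜ extendedᶜ cutᶜ nextᶜ stepsᶜ codedᶜ : Term 1
topAtᶜ valueAtᶜ graphOfᶜ : Formula 2
isCodeᶜ movesᶜ colourᶜ inGraphᶜ inDomainᶜ colouringCodeᶜ : Formula 1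

topAtᶜ = as bit (testBitᶜ (var v₀) (var v₁) ∧ᶜ (lowᶜ (sucᶜ (var v₀)) (var v₁) ≡ᶜ var v₁)
                   ∧ᶜ oracleᶜ (const 2 *ᶜ lowᶜ (var v₀) (var v₁)))
  (λ { A (m ∷ u ∷ []) → topAt A u m }) λ { A (m ∷ u ∷ []) → refl }

topᶜ = as id (leastᶜ (var v₀) topAtᶜ) (λ { A (u ∷ []) → top A u }) λ { A (u ∷ []) → refl }

isCodeᶜ = as bit (app topAtᶜ (topᶜ ∷ var v₀ ∷ [])) (λ { A (u ∷ []) → isCode A u }) λ { A (u ∷ []) → cong bit (isCode-def A u) }

valueAtᶜ = as bit ((var v₀ <ᶜ t) ∧ᶜ notᶜ (testBitᶜ (var v₀) (var v₁))
                     ∧ᶜ oracleᶜ (const 2 *ᶜ pairᶜ (lowᶜ t (var v₁)) (var v₀) +ᶜ const 1))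
  (λ { A (x ∷ u ∷ []) → valueAt A u x }) λ { A (x ∷ u ∷ []) → refl }
  where t = app topᶜ (var v₁ ∷ [])

newᶜ = as id (leastᶜ (var v₀) valueAtᶜ) (λ { A (u ∷ []) → newElement A u }) λ { A (u ∷ []) → newElement-def A u }

extendedᶜ = as id ((const 2 ^ᶜ newᶜ) +ᶜ var v₀) (λ { A (u ∷ []) → extended A u }) λ { A (u ∷ []) → refl }

cutᶜ = as id (leastᶜ (sucᶜ (var v₀)) (app isCodeᶜ (lowᶜ (var v₀) (app extendedᶜ (var v₁ ∷ [])) ∷ [])))
  (λ { A (u ∷ []) → cut A u }) λ { A (u ∷ []) → refl }

nextᶜ = as id (lowᶜ cutᶜ extendedᶜ) (λ { A (u ∷ []) → next A u }) λ { A (u ∷ []) → next-def A u }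

movesᶜ = as bit (app valueAtᶜ (newᶜ ∷ var v₀ ∷ []) ∧ᶜ app isCodeᶜ (nextᶜ ∷ []))
  (λ { A (u ∷ []) → moves A u }) λ { A (u ∷ []) → cong bit (moves-def A u) }

orbitᶜ : Term 2
orbitᶜ = as id (rec (var v₀) (app nextᶜ (var v₁ ∷ []))) (λ { A (k ∷ u ∷ []) → orbit A k u })
  λ { A (k ∷ u ∷ []) → eq A k u }
  where
  eq : ∀ A k u → natrec u (λ _ → next A) k ≡ orbit A k u
  eq A zero    u = refl
  eq A (suc k) u = cong (next A) (eq A k u)

stepsᶜ = as id (leastᶜ (const 2 ^ᶜ var v₀) (notᶜ (app movesᶜ (orbitᶜ ∷ []))))
  (λ { A (u ∷ []) → steps A u }) λ { A (u ∷ []) → steps-def A u }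

colourᶜ = as bit (oddᶜ stepsᶜ) (λ { A (u ∷ []) → colour A u }) λ { A (u ∷ []) → refl }

graphOfᶜ = as bit (app isCodeᶜ (var v₀ ∷ [])
                     ∧ᶜ (pairᶜ (const 2 *ᶜ var v₀) (bitᶜ (app colourᶜ (var v₀ ∷ []))) ≡ᶜ var v₁))
  (λ { A (u ∷ N ∷ []) → graphOf A N u }) λ { A (u ∷ N ∷ []) → refl }

codedᶜ = as id (leastᶜ (sucᶜ (var v₀)) graphOfᶜ) (λ { A (N ∷ []) → coded A N }) λ { A (N ∷ []) → refl }

inGraphᶜ = as bit (app graphOfᶜ (codedᶜ ∷ var v₀ ∷ []))
  (λ { A (N ∷ []) → inGraph A N }) λ { A (N ∷ []) → refl }

inDomainᶜ = as bit (notᶜ (oddᶜ (var v₀)) ∧ᶜ app isCodeᶜ (halfᶜ (var v₀) ∷ []))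
  (λ { A (k ∷ []) → inDomain A k }) λ { A (k ∷ []) → refl }

colouringCodeᶜ = as bit (ifᶜ (oddᶜ (var v₀)) (app inGraphᶜ (halfᶜ (var v₀) ∷ [])) (app inDomainᶜ (halfᶜ (var v₀) ∷ [])))
  (λ { A (n ∷ []) → colouringCode A n }) λ { A (n ∷ []) → refl }

-- Correctness of the colouring

T-not : ∀ {b} → ¬ T b → T (not b)
T-not {false} _ = _
T-not {true}  p = p _

not-T : ∀ {b} → T (not b) → ¬ T b
not-T {false} _ ()

¬T⇒false : ∀ {b} → ¬ T b → b ≡ false
¬T⇒false = to T-not-≡ ∘ T-not

record IsTop (A : Subsetℕ) (u m : ℕ) : Set where
  constructor isTop
  field
    m∈u    : m ε u
    u≤m    : ∀ y → y ε u → y ≤ m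
    init∈B : T (A (2 * low m u))

  m∉init : ¬ m ε low m u
  m∉init r = <-irrefl refl (proj₁ (to (ε-low m u m) r))

topAt-sound : ∀ A u m → T (topAt A u m) → IsTop A u m
topAt-sound A u m p = let m∈ , q = to T-∧ p ; e , a = to T-∧ q in isTop m∈
  (λ y y∈ → ≤-pred (proj₁ (to (ε-low (suc m) u y) (subst (y ε_) (sym (≡ᵇ⇒≡ _ _ e)) y∈)))) a

topAt-complete : ∀ {A u m} → IsTop A u m → T (topAt A u m)
topAt-complete {A} {u} {m} (isTop m∈ ≤m a) = from T-∧ (m∈ , from T-∧ (≡⇒≡ᵇ _ _ (ε-ext
  (λ y → proj₂ ∘ to (ε-low (suc m) u y))
  (λ y y∈ → from (ε-low (suc m) u y) (s≤s (≤m y y∈) , y∈))) , a))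

isCode-sound : ∀ A u → T (isCode A u) → IsTop A u (top A u)
isCode-sound A u p = topAt-sound A u (top A u) (subst T (sym (isCode-def A u)) p)

IsTop⇒isCode : ∀ {A u m} → IsTop A u m → T (isCode A u)
IsTop⇒isCode {A} {u} {m} t = subst T (isCode-def A u)
  (least-finds u (topAt A u) (ε⇒< m u (IsTop.m∈u t)) (topAt-complete t))

IsTop⇒top≡ : ∀ {A u m} → IsTop A u m → top A u ≡ m
IsTop⇒top≡ {A} {u} {m} t = ≤-antisym (T₁.u≤m _ T₂.m∈u) (T₂.u≤m _ T₁.m∈u)
  where
  module T₁ = IsTop t
  module T₂ = IsTop (isCode-sound A u (IsTop⇒isCode t))

valueAt-sound : ∀ A u x → T (valueAt A u x) →
                x < top A u × ¬ x ε u × T (A (2 * pair (low (top A u) u) x + 1))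
valueAt-sound A u x p = let l , q = to T-∧ p ; n , a = to T-∧ q in <ᵇ⇒< _ _ l , not-T n , a

valueAt-complete : ∀ {A u x} → x < top A u → ¬ x ε u → T (A (2 * pair (low (top A u) u) x + 1)) →
                   T (valueAt A u x)
valueAt-complete l n a = from T-∧ (<⇒<ᵇ l , from T-∧ (T-not n , a))

orbit-next : ∀ A k u → orbit A k (next A u) ≡ orbit A (suc k) u
orbit-next A zero    u = refl
orbit-next A (suc k) u = cong (next A) (orbit-next A k u)

increasing⇒reflects-< : ∀ {e : ℕ → ℕ} → (∀ {i j} → i < j → e i < e j) → ∀ {i j} → e i < e j → i < j
increasing⇒reflects-< {e} mono {i} {j} lt with <-cmp i j
... | tri< i<j _ _  = i<j
... | tri≈ _ refl _ = contradiction lt (<-irrefl refl)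
... | tri> _ _ j<i  = contradiction lt (<-asym (mono j<i))

-- Moves between codes, for a fixed barrier and a coded instance

module _ {B : Family} (bar : IsBarrierOn U B) {A : Subsetℕ} {f : Coloring B ℕ}
         (codes : CodesColoring B A f) where
  open IsBarrierOn bar
  open CodesColoring codes

  toSet∈ : ∀ i → T (A (2 * i)) → toSet i ∈ B
  toSet∈ i a = to (domain (toSet i)) (subst (λ k → T (A (2 * k))) (sym (index-toSet i)) a)

  code-antichain : ∀ i j m → T (A (2 * i)) → T (A (2 * j)) →
                   (∀ y → y ε i → y ε j) → m ε j → ¬ m ε i → ⊥
  code-antichain i j m a b i⊆j m∈j m∉i = antichain (toSet i) (toSet j) (toSet∈ i a) (toSet∈ j b)
    ( (λ {y} → from (∈-toSet j y) ∘ i⊆j y ∘ to (∈-toSet i y))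
    , λ j⊆i → m∉i (to (∈-toSet i m) (j⊆i (from (∈-toSet j m) m∈j))))

  -- The barrier meets the infinite set `Y` that agrees with `u ∪ {x}` up to `m` and contains
  -- everything above `m`. The resulting member of `B`, with the next element of `Y` appended, is
  -- the initial segment sought.
  cut-exists : ∀ {u x} → T (isCode A u) → x < top A u → ¬ x ε u →
               ∃[ j ] j ≤ u × T (isCode A (low j (2 ^ x + u)))
  cut-exists {u} {x} p x<m x∉u = result
    where
    v = 2 ^ x + u
    m = top A u
    open IsTop (isCode-sound A u p)
    u⊆v : ∀ y → y ε u → y ε v
    u⊆v y y∈ = from (ε-2^+ x u x∉u y) (inj₂ y∈)
    -- v continued by all numbers above m
    Y : Subsetℕ
    Y y = if m <ᵇ y then true else testBit y v
    Y-above : ∀ y → m < y → T (Y y)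
    Y-above y l with m <ᵇ y in eq
    ... | true  = _
    ... | false = ⊥-elim (subst T eq (<⇒<ᵇ l))
    Y-below : ∀ y → y ≤ m → T (Y y) ⇔ y ε v
    Y-below y l with m <ᵇ y in eq
    ... | true  = contradiction (<ᵇ⇒< m y (subst T (sym eq) _)) (≤⇒≯ l)
    ... | false = mk⇔ id id
    result : ∃[ j ] j ≤ u × T (isCode A (low j v))
    result with covering Y (λ n → suc m ⊔ n , m≤n⊔m (suc m) n , Y-above _ (m≤m⊔n (suc m) n)) (λ _ → tt)
    -- `s` consists of the first `k` elements of `Y`, so `e k` is the element to append, and the cut
    -- must lie just above it.
    ... | s , s∈B , e , k , (mono , enum) , es = suc (e k) , ≤-<-trans ek≤m (ε⇒< m u m∈u) ,
      IsTop⇒isCode (isTop ek∈w (λ y → ≤-pred ∘ proj₁ ∘ to (ε-low (suc (e k)) v y))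
        (subst (λ i → T (A (2 * i))) (sym low≡) (from (domain s) s∈B)))
      where
      w = low (suc (e k)) v
      ∈s : ∀ y → y ε index s ⇔ (y < e k × T (Y y))
      ∈s y = mk⇔ ⇒ ⇐
        where
        ⇒ : y ε index s → y < e k × T (Y y)
        ⇒ q with ∈-map⁻ e (subst (y List.∈_) es (to (ε-index s y) q))
        ... | i , i∈ , refl = mono (∈-upTo⁻ i∈) , from (enum (e i)) (i , refl)
        ⇐ : y < e k × T (Y y) → y ε index s
        ⇐ (lt , q) with to (enum y) q
        ... | i , refl = from (ε-index s _) (subst (e i List.∈_) (sym es)
                           (∈-map⁺ e (∈-upTo⁺ (increasing⇒reflects-< mono lt))))
      ek≤m : e k ≤ m
      -- Otherwise `s` would contain all of `u` up to and including `m`, and so properly contain the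
      -- part of `u` in `B`.
      ek≤m = ≮⇒≥ λ m<ek → code-antichain (low m u) (index s) m init∈B (from (domain s) s∈B)
        (λ y q → let y<m , y∈ = to (ε-low m u y) q in
          from (∈s y) (<-trans y<m m<ek , from (Y-below y (<⇒≤ y<m)) (u⊆v y y∈)))
        (from (∈s m) (m<ek , from (Y-below m ≤-refl) (u⊆v m m∈u)))
        m∉init
      ek∈w : e k ε w
      ek∈w = from (ε-low (suc (e k)) v (e k)) (≤-refl , to (Y-below (e k) ek≤m) (from (enum (e k)) (k , refl)))
      low≡ : low (e k) w ≡ index s
      low≡ = ε-ext
        (λ y q → let y<ek , y∈w = to (ε-low (e k) w y) q
                     _ , y∈v = to (ε-low (suc (e k)) v y) y∈w in
          from (∈s y) (y<ek , from (Y-below y (≤-trans (<⇒≤ y<ek) ek≤m)) y∈v))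
        (λ y q → let y<ek , y∈Y = to (∈s y) q in
          from (ε-low (e k) w y) (y<ek , from (ε-low (suc (e k)) v y)
            (m<n⇒m<1+n y<ek , to (Y-below y (≤-trans (<⇒≤ y<ek) ek≤m)) y∈Y)))

  -- The given `x` lies below the search bound, so `newElement` finds a value, possibly another one;
  -- `cut-exists` then makes the search for the cut succeed.
  moves-exists : ∀ {u x} → T (isCode A u) → T (valueAt A u x) → T (moves A u)
  moves-exists {u} {x} p q = subst T (moves-def A u) (from T-∧ (q′ , subst (T ∘ isCode A) (next-def A u)
    (least-finds (suc u) (λ j → isCode A (low j (extended A u))) (s≤s (proj₁ (proj₂ ex))) (proj₂ (proj₂ ex)))))
    where
    x<u : x < u
    x<u = <-trans (proj₁ (valueAt-sound A u x q)) (ε⇒< _ u (IsTop.m∈u (isCode-sound A u p)))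
    q′ : T (valueAt A u (newElement A u))
    q′ = subst (T ∘ valueAt A u) (newElement-def A u) (least-finds u (valueAt A u) x<u q)
    ex : ∃[ j ] j ≤ u × T (isCode A (low j (extended A u)))
    ex = let new<top , new∉u , _ = valueAt-sound A u (newElement A u) q′ in cut-exists {u} p new<top new∉u

  module Move {u} (p : T (isCode A u)) (q : T (moves A u)) where
    x w : ℕ
    x = newElement A u
    w = next A u
    open IsTop (isCode-sound A u p)
    x-value : T (valueAt A u x)
    x-value = proj₁ (to T-∧ (subst T (sym (moves-def A u)) q))
    x<m : x < top A u
    x<m = proj₁ (valueAt-sound A u x x-value)
    x∉u : ¬ x ε u
    x∉u = proj₁ (proj₂ (valueAt-sound A u x x-value))
    isCode-next : T (isCode A w)
    isCode-next = proj₂ (to (T-∧ {valueAt A u x}) (subst T (sym (moves-def A u)) q))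
    ∈w : ∀ y → y ε w ⇔ (y < cut A u × (y ≡ x ⊎ y ε u))
    ∈w y = subst (λ w → y ε w ⇔ (y < cut A u × (y ≡ x ⊎ y ε u))) (next-def A u) (mk⇔
      (λ r → let l , s = to (ε-low (cut A u) (extended A u) y) r in l , to (ε-2^+ x u x∉u y) s)
      (λ (l , s) → from (ε-low (cut A u) (extended A u) y) (l , from (ε-2^+ x u x∉u y) s)))
    -- otherwise the member of B given by w would be a proper subset of that given by u
    x<cut : x < cut A u
    x<cut = ≰⇒> λ cut≤x →
      let module W = IsTop (isCode-sound A w isCode-next)
          w⊆i : ∀ y → y ε w → y ε low (top A u) u
          w⊆i y y∈w = let l , s = to (∈w y) y∈w ; y<x = <-≤-trans l cut≤x in
            from (ε-low (top A u) u y) (<-trans y<x x<m ,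
              [ (λ e → contradiction y<x (<-irrefl e)) , id ]′ s)
      in code-antichain (low (top A w) w) (low (top A u) u) (top A w) W.init∈B init∈B
           (λ y r → w⊆i y (proj₂ (to (ε-low (top A w) w y) r))) (w⊆i (top A w) W.m∈u) W.m∉init
    -- By `x<cut`, cutting removes nothing up to `x`: both sets agree below `x`, and only `w`
    -- contains `x`.
    next-lex : ∀ {M} → (∀ y → y ε u → y < M) →
               lexValue M (λ y → testBit y u) < lexValue M (λ y → testBit y w)
    next-lex {M} u<M = lexValue-< M x _ _ (<-trans x<m (u<M _ m∈u))
      (λ y y<x → T-ext (λ r → from (∈w y) (<-trans y<x x<cut , inj₂ r))
        (λ r → [ (λ e → contradiction y<x (<-irrefl e)) , id ]′ (proj₂ (to (∈w y) r))))
      (¬T⇒false x∉u) (to T-≡ (from (∈w x) (x<cut , inj₁ refl)))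
    next-bounded : ∀ {M} → (∀ y → y ε u → y < M) → ∀ y → y ε w → y < M
    next-bounded u<M y r =
      [ (λ { refl → <-trans x<m (u<M _ m∈u) }) , u<M y ]′ (proj₂ (to (∈w y) r))

  -- After `k` uninterrupted moves the lexicographic value is at least `k`, which is impossible for
  -- `k = 2 ^ u`.
  orbit-stops : ∀ u → T (isCode A u) → ∃[ k ] k < 2 ^ u × T (not (moves A (orbit A k u)))
  orbit-stops u p = [ (λ climb → contradiction (lexValue<2^ u _) (≤⇒≯ (proj₂ (proj₂ climb)))) , id ]′ (run (2 ^ u))
    where
    run : ∀ k → (T (isCode A (orbit A k u)) × (∀ y → y ε orbit A k u → y < u) ×
                 k ≤ lexValue u (λ y → testBit y (orbit A k u)))
              ⊎ (∃[ i ] i < k × T (not (moves A (orbit A i u))))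
    run zero    = inj₁ (p , (λ y → ε⇒< y u) , z≤n)
    run (suc k) with run k
    ... | inj₂ (i , i<k , r) = inj₂ (i , m<n⇒m<1+n i<k , r)
    ... | inj₁ (c , b , l) with T? (moves A (orbit A k u))
    ...   | no ¬r = inj₂ (k , ≤-refl , T-not ¬r)
    ...   | yes r = inj₁ (isCode-next , next-bounded b , ≤-<-trans l (next-lex b))
      where open Move {orbit A k u} c r

  -- The searches defining `steps` for `u` and for `w` have different bounds, but both succeed, so
  -- both return the true first stopping time. The orbit of `w` is that of `u` without its first
  -- term, so the two times differ by one.
  colour-next : ∀ {u} → T (isCode A u) → T (moves A u) → colour A u ≡ not (colour A (next A u))
  colour-next {u} p q = cong odd steps≡
    where
    w = next A u
    c : T (isCode A w)
    c = Move.isCode-next {u} p q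
    stopped : ∀ u → ℕ → Bool
    stopped u k = not (moves A (orbit A k u))
    finds : ∀ u → T (isCode A u) → T (stopped u (steps A u))
    finds u p = let _ , k< , r = orbit-stops u p in
      subst (T ∘ stopped u) (steps-def A u) (least-finds (2 ^ u) (stopped u) k< r)
    minimal : ∀ u {k} → k < steps A u → ¬ T (stopped u k)
    minimal u k< = least-minimal (2 ^ u) (stopped u) (subst (_ <_) (sym (steps-def A u)) k<)
    shift-stopped : ∀ k → stopped u (suc k) ≡ stopped w k
    shift-stopped k = cong (not ∘ moves A) (sym (orbit-next A k u))
    steps≡ : steps A u ≡ suc (steps A w)
    steps≡ with <-cmp (steps A u) (suc (steps A w))
    ... | tri≈ _ e _ = e
    ... | tri> _ _ gt = contradiction (subst T (sym (shift-stopped (steps A w))) (finds w c))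
                          (minimal u gt)
    ... | tri< lt _ _ = ⊥-elim (early (steps A u) lt (finds u p))
      where
      early : ∀ k → k < suc (steps A w) → ¬ T (stopped u k)
      early zero    _        r = not-T r q
      early (suc k) (s≤s lt) r =
        minimal w lt (subst T (shift-stopped k) r)

  -- Codes and members of `B ⁺`

  -- Some member of `B` contains 0, and the empty set would be properly included in it.
  nonempty : ∀ {s} → s ∈ B → ∃[ x ] x List.∈ elems s
  nonempty {finSet (x ∷ l) _} _ = x , here refl
  nonempty {finSet [] q} s∈B with from (union 0) tt
  ... | t , t∈B , 0∈t = ⊥-elim (antichain (finSet [] q) t s∈B t∈B ((λ ()) , λ t⊆∅ → ∉[] (t⊆∅ 0∈t)))
    where
    ∉[] : ∀ {x : ℕ} → ¬ (x List.∈ [])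
    ∉[] ()

  appended : ∀ {s m} → s ∈ B → (∀ x → x List.∈ elems s → x < m) →
             let u = 2 ^ m + index s in
             (∀ y → y ε u ⇔ (y ≡ m ⊎ y List.∈ elems s)) ×
             T (isCode A u) × top A u ≡ m × low m u ≡ index s
  appended {s} {m} s∈B s<m = ∈u , IsTop⇒isCode top-m , IsTop⇒top≡ top-m , low≡
    where
    u = 2 ^ m + index s
    ins = ε-2^+ m (index s) (λ r → <-irrefl refl (s<m m (to (ε-index s m) r)))
    ∈u : ∀ y → y ε u ⇔ (y ≡ m ⊎ y List.∈ elems s)
    ∈u y = mk⇔ (λ r → [ inj₁ , inj₂ ∘ to (ε-index s y) ]′ (to (ins y) r))
               (λ r → from (ins y) ([ inj₁ , inj₂ ∘ from (ε-index s y) ]′ r))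
    low≡ : low m u ≡ index s
    low≡ = ε-ext
      (λ y r → let y<m , y∈u = to (ε-low m u y) r in
        [ (λ e → contradiction y<m (<-irrefl e)) , from (ε-index s y) ]′ (to (∈u y) y∈u))
      (λ y r → let y∈s = to (ε-index s y) r in from (ε-low m u y) (s<m y y∈s , from (∈u y) (inj₂ y∈s)))
    top-m : IsTop A u m
    top-m = isTop (from (∈u m) (inj₁ refl))
      (λ y r → [ ≤-reflexive , <⇒≤ ∘ s<m y ]′ (to (∈u y) r))
      (subst (λ i → T (A (2 * i))) (sym low≡) (from (domain s) s∈B))

  ⁺⇒isCode : ∀ t → t ∈ B ⁺ → ∃[ u ] index t ≡ 2 * u × T (isCode A u)
  ⁺⇒isCode t (s , .(suc m) , s∈B , (m , _ , refl) , max< , t≡) =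
    2 ^ m + index s , trans (cong (sum ∘ map (2 ^_)) t≡) (index-⁺ (elems s) m) ,
    proj₁ (proj₂ (appended {s} s∈B (λ x x∈ → ≤-<-trans (All.lookup (xs≤max 0 (elems s)) x∈)
      (≤-pred (subst (_< suc m) (+-comm _ 1) max<)))))

  isCode⇒⁺ : ∀ t u → index t ≡ 2 * u → T (isCode A u) → t ∈ B ⁺
  isCode⇒⁺ t u it p = s , suc m , toSet∈ i init∈B , (m , from (union m) tt , refl) ,
    subst (_< suc m) (+-comm 1 _) (s≤s (max<v⁺ 0<m (All.tabulate s<m))) ,
    increasing-ext (increasing! t) increasing⁺
      (λ x r → to (∈-index _ increasing⁺ x) (subst (x ε_) (trans it 2u≡) (from (ε-index t x) r)))
      (λ x r → to (ε-index t x) (subst (x ε_) (sym (trans it 2u≡)) (from (∈-index _ increasing⁺ x) r)))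
    where
    m = top A u
    i = low m u
    s = toSet i
    open IsTop (isCode-sound A u p)
    s<m : ∀ {x} → x List.∈ elems s → x < m
    s<m {x} r = proj₁ (to (ε-low m u x) (to (∈-toSet (low m u) x) r))
    -- `max` has default value 0, which must lie below `m` as well.
    0<m : 0 < m
    0<m = ≤-<-trans z≤n (s<m (proj₂ (nonempty {s} (toSet∈ i init∈B))))
    snoc : ∀ {l} → Linked _<_ l → (∀ {x} → x List.∈ l → x < m) → Linked _<_ (map suc l ∷ʳ suc m)
    snoc []      _ = [-]
    snoc [-]     h = s<s (h (here refl)) ∷ [-]
    snoc (lt ∷ p) h = s<s lt ∷ snoc p (h ∘ there)
    increasing⁺ = snoc (increasing! s) s<m
    u≡ : u ≡ 2 ^ m + low m u
    u≡ = ε-ext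
      (λ y r → from (ins y) ([ (λ lt → inj₂ (from (ε-low m u y) (lt , r))) , inj₁ ]′ (m≤n⇒m<n∨m≡n (u≤m y r))))
      (λ y r → [ (λ { refl → m∈u }) , proj₂ ∘ to (ε-low m u y) ]′ (to (ins y) r))
      where ins = ε-2^+ m (low m u) m∉init
    2u≡ : 2 * u ≡ sum (map (2 ^_) (map suc (elems s) ∷ʳ suc m))
    2u≡ = trans (cong (2 *_) (trans u≡ (cong (2 ^ m +_) (sym (index-toSet (low m u))))))
                (sym (index-⁺ (elems s) m))

  -- The coloured instance and its code

  colourAt : FinSet → Fin 2
  colourAt t = if colour A ⌊ index t /2⌋ then suc zero else zero

  colourOf : Coloring (B ⁺) (Fin 2)
  colourOf t _ = colourAt t

  colourAt-2* : ∀ t u → index t ≡ 2 * u → toℕ (colourAt t) ≡ bit (colour A u)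
  colourAt-2* t u e = trans (toℕ-if (colour A ⌊ index t /2⌋))
    (cong (bit ∘ colour A) (trans (cong ⌊_/2⌋ e) (⌊2*k/2⌋ u)))
    where
    toℕ-if : ∀ b → toℕ {2} (if b then suc zero else zero) ≡ bit b
    toℕ-if false = refl
    toℕ-if true  = refl

  colouringCode-even : ∀ k → colouringCode A (2 * k) ≡ inDomain A k
  colouringCode-even k rewrite odd-2* k | ⌊2*k/2⌋ k = refl

  colouringCode-odd : ∀ k → colouringCode A (2 * k + 1) ≡ inGraph A k
  colouringCode-odd k rewrite odd-2*+ k 1 | ⌊2*k+n/2⌋ k 1 | +-identityʳ k = refl

  codes⁺ : CodesColoring (B ⁺) (colouringCode A) (λ t p → toℕ (colourOf t p))
  codes⁺ = record
    { domain = λ t → mk⇔ (domain⇒ t) (domain⇐ t)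
    ; graph  = λ t n → mk⇔ (graph⇒ t n) (graph⇐ t n) }
    where
    domain⇒ : ∀ t → T (colouringCode A (2 * index t)) → t ∈ B ⁺
    domain⇒ t r =
      let ev , c = to T-∧ (subst T (colouringCode-even (index t)) r) in
      isCode⇒⁺ t _ (even⇒≡2* (index t) (to T-not-≡ ev)) c
    domain⇐ : ∀ t → t ∈ B ⁺ → T (colouringCode A (2 * index t))
    domain⇐ t r = let u , e , c = ⁺⇒isCode t r in
      subst T (sym (trans (colouringCode-even (index t)) (cong (inDomain A) e)))
        (from T-∧ (from T-not-≡ (odd-2* u) , subst (T ∘ isCode A) (sym (⌊2*k/2⌋ u)) c))
    graph⇒ : ∀ t n → T (colouringCode A (2 * pair (index t) n + 1)) →
             Σ[ p ∈ t ∈ B ⁺ ] toℕ (colourOf t p) ≡ n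
    graph⇒ t n r =
      let N = pair (index t) n
          u = coded A N
          c , e = to (T-∧ {isCode A u}) (subst T (colouringCode-odd N) r)
          -- The search only guarantees some `u` whose pair is `N`; injectivity of pairing
          -- identifies its set with `t` and its colour with `n`.
          2u≡ , b≡ = pair-injective (2 * u) (bit (colour A u)) (index t) n (≡ᵇ⇒≡ _ _ e) in
      isCode⇒⁺ t u (sym 2u≡) c , trans (colourAt-2* t u (sym 2u≡)) b≡
    graph⇐ : ∀ t n → Σ[ p ∈ t ∈ B ⁺ ] toℕ (colourOf t p) ≡ n →
             T (colouringCode A (2 * pair (index t) n + 1))
    graph⇐ t n (p , refl) =
      let N = pair (index t) n
          u , e , c = ⁺⇒isCode t p
          pair≡ : pair (2 * u) (bit (colour A u)) ≡ N
          pair≡ = cong₂ pair (sym e) (sym (colourAt-2* t u e)) in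
      subst T (sym (colouringCode-odd N)) (least-finds (suc N) (graphOf A N) {u}
        (s≤s (≤-trans (m≤m+n u _) (subst (2 * u ≤_) pair≡ (≤pair (2 * u) _))))
        (from T-∧ (c , ≡⇒≡ᵇ _ _ pair≡)))

  -- From homogeneous sets to free sets

  module _ {H : Subsetℕ} (infinite-H : Infinite ⟦ H ⟧)
           (homogeneous : ∀ s t (p : s ∈ B ⁺ ↾ H) (q : t ∈ B ⁺ ↾ H) →
                          colourOf s (proj₁ p) ≡ colourOf t (proj₁ q)) where

    -- The set with code `2 * u` is the shift of the one coded by `u`, so it is a member of `B ⁺`
    -- inside `H`.
    homogeneous-codes : ∀ u w → T (isCode A u) → T (isCode A w) →
                        (∀ y → y ε u → T (H (suc y))) → (∀ y → y ε w → T (H (suc y))) →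
                        colour A u ≡ colour A w
    homogeneous-codes u w cu cw hu hw = bit-injective (trans (sym (colourAt-2* (t u) u (it u)))
      (trans (cong toℕ (homogeneous (t u) (t w) (∈⁺ u cu hu) (∈⁺ w cw hw))) (colourAt-2* (t w) w (it w))))
      where
      t : ℕ → FinSet
      t u = toSet (2 * u)
      it : ∀ u → index (t u) ≡ 2 * u
      it u = index-toSet (2 * u)
      ∈⁺ : ∀ u → T (isCode A u) → (∀ y → y ε u → T (H (suc y))) → t u ∈ B ⁺ ↾ H
      ∈⁺ u c h = isCode⇒⁺ (t u) u (it u) c , λ {x} r → ∈H x (to ε-2* (to (∈-toSet (2 * u) x) r))
        where
        ∈H : ∀ x → ∃[ y ] x ≡ suc y × y ε u → T (H x)
        ∈H x (y , refl , y∈) = h y y∈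
      bit-injective : ∀ {a b} → bit a ≡ bit b → a ≡ b
      bit-injective {false} {false} _ = refl
      bit-injective {true}  {true}  _ = refl

    free : ∀ s (p : s ∈ B ↾ (H ∘ suc)) → T (H (suc (f s (proj₁ p)))) → f s (proj₁ p) List.∈ elems s
    free s (s∈B , s⊆H) x∈H with T? (testBit (f s s∈B) (index s))
    ... | yes r  = to (ε-index s _) r
    -- The predecessor `m` of such an element of `H` exceeds `x` and also `index s`, hence every
    -- element of `s`.
    ... | no x∉s = ⊥-elim (absurd (infinite-H (2 + (x ⊔ index s))))
      where
      x = f s s∈B
      absurd : ∃[ h ] 2 + (x ⊔ index s) ≤ h × T (H h) → ⊥
      absurd (suc m , s≤s lt , m∈H) = not-¬ same (colour-next {u} c mv)
        where
        u = 2 ^ m + index s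
        s<m : ∀ y → y List.∈ elems s → y < m
        s<m y r = <-trans (ε⇒< y (index s) (from (ε-index s y) r)) (≤-trans (s≤s (m≤n⊔m x (index s))) lt)
        ap = appended {s} s∈B s<m
        ∈u = proj₁ ap
        c = proj₁ (proj₂ ap)
        top≡ = proj₁ (proj₂ (proj₂ ap))
        i≡ : low (top A u) u ≡ index s
        i≡ = trans (cong (λ k → low k u) top≡) (proj₂ (proj₂ (proj₂ ap)))
        x<m : x < m
        x<m = ≤-trans (s≤s (m≤m⊔n x (index s))) lt
        mv : T (moves A u)
        mv = moves-exists {u} {x} c (valueAt-complete {A} (subst (x <_) (sym top≡) x<m)
          (λ r → [ (λ e → <-irrefl e x<m) , x∉s ∘ from (ε-index s x) ]′ (to (∈u x) r))
          (subst (λ i → T (A (2 * pair i x + 1))) (sym i≡) (from (graph s x) (s∈B , refl))))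
        open Move {u} c mv using (w; ∈w; x-value; isCode-next)
        -- Whatever the search found is a value of `f` at `s`, and the graph is single-valued.
        new≡x : newElement A u ≡ x
        new≡x = sym (proj₂ (to (graph s (newElement A u)) (subst (λ i → T (A (2 * pair i (newElement A u) + 1))) i≡
          (proj₂ (proj₂ (valueAt-sound A u (newElement A u) x-value))))))
        u⊆H : ∀ y → y ε u → T (H (suc y))
        u⊆H y r = [ (λ { refl → m∈H }) , s⊆H ]′ (to (∈u y) r)
        w⊆H : ∀ y → y ε w → T (H (suc y))
        w⊆H y r = [ (λ e → subst (λ z → T (H (suc z))) (sym (trans e new≡x)) x∈H) , u⊆H y ]′ (proj₂ (to (∈w y) r))
        same : colour A u ≡ colour A w
        same = homogeneous-codes u w c isCode-next u⊆H w⊆H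

    infinite-shifted : Infinite ⟦ H ∘ suc ⟧
    infinite-shifted n with infinite-H (suc n)
    ... | suc m , s≤s n≤m , m∈H = m , n≤m , m∈H

theorem6 : ∀ (B : Family) → IsBarrierOn U B → FS B ≤sW RT (B ⁺) 2
-- Both programs are the same for all barriers, as `B` is read off from the oracle. The second one
-- consults only `H` and returns `H − 1`, so the reduction is strong.
theorem6 B bar = prog colouringCodeᶜ , prog shifted , λ f A codes →
  colouringCode A , colourOf bar codes , (λ n → correct colouringCodeᶜ A (n ∷ [])) , codes⁺ bar codes ,
  λ H (infinite-H , _ , homogeneous) →
    H ∘ suc , (λ n → correct shifted H (n ∷ [])) ,
    infinite-shifted bar codes infinite-H homogeneous ,
    (λ {y} _ → from (IsBarrierOn.union bar y) tt) ,
    free bar codes infinite-H homogeneous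
  where
  shifted : Formula 1
  shifted = oracleᶜ (sucᶜ (var v₀))
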